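{- For every integer $n\ge 3$, $$\gamma_t(C_n\times C_4)=\gamma_p(C_n\times C_4)=\begin{cases} n, & \text{if } n\equiv 0 \pmod 4,\\ n+1, & \text{if } n\equiv 1,3 \pmod 4,\\ n+2, & \text{if } n\equiv 2\pmod 4.\end{cases}$$
   Context: All graphs are finite, simple and undirected. $C_n$ denotes the cycle of order $n$ and $G\times H$ the Cartesian product of graphs. For a graph $G$ without isolated vertices: a set $D\subseteq V(G)$ is a total dominating set if every vertex of $G$ (including those in $D$) has a neighbour in $D$; $\gamma_t(G)$ is the minimum size of a total dominating set. A set $D\subseteq V(G)$ is a paired dominating set if every vertex outside $D$ has a neighbour in $D$ and the induced subgraph $G[D]$ has a perfect matching; $\gamma_p(G)$ is the minimum size of a paired dominating set. -}

module Defs where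

open import Data.Fin.Base using (Fin; zero; suc; toℕ)
open import Data.Fin.Properties using (*↔×)
open import Data.Fin.Subset using (Subset; Side; inside; outside; ∣_∣; _∈_)
open import Data.Nat.Base using (ℕ; suc; _≤_; _*_; s≤s)
open import Data.Nat.Properties using (1+n≢n)
open import Data.Product using (∃; ∃!; _×_; _,_; proj₁)
open import Data.Product.Function.NonDependent.Propositional using (_×-↔_)
import Data.Product.Function.Dependent.Propositional as Σ-Function
open import Data.Sum.Base using (_⊎_; inj₁; inj₂; swap)
open import Data.Vec.Base using ([]; _∷_; here; there)
open import Function.Base using (_on_)
open import Function.Bundles using (Inverse; _↔_; mk↔ₛ′)
open import Function.Construct.Composition using (_↔-∘_)
open import Function.Construct.Identity using (↔-id)
open import Function.Construct.Symmetry using (↔-sym)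
open import Level using (Level; 0ℓ)
open import Relation.Binary.Core using (Rel; _⇒_)
open import Relation.Binary.Definitions using (Symmetric; Irreflexive)
open import Relation.Binary.PropositionalEquality
  using (_≡_; refl; sym; cong)
open import Relation.Nullary.Negation using (¬_)


record Graph : Set₁ where
  field
    Vertex : Set
    order  : ℕ
    finite : Vertex ↔ Fin order
    Adj    : Rel Vertex 0ℓ
    adj-sym    : Symmetric Adj
    adj-irrefl : Irreflexive _≡_ Adj

  -- Sets of vertices are subsets of Fin order, read through the enumeration
  -- of the vertices, so that ∣_∣ is the number of vertices in the set.
  VertexSet : Set
  VertexSet = Subset order

  infix 4 _∈ᵥ_ _∉ᵥ_

  _∈ᵥ_ : Vertex → VertexSet → Set
  v ∈ᵥ D = Inverse.to finite v ∈ D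

  _∉ᵥ_ : Vertex → VertexSet → Set
  v ∉ᵥ D = ¬ (v ∈ᵥ D)

  HasNeighbourIn : Vertex → VertexSet → Set
  HasNeighbourIn v D = ∃ λ u → Adj v u × u ∈ᵥ D

open Graph

-- j follows i in the cyclic order 0, 1, …, n ∸ 1, 0.
Next : ∀ {n} → Rel (Fin n) 0ℓ
Next {n} i j = (toℕ j ≡ suc (toℕ i)) ⊎ (suc (toℕ i) ≡ n × toℕ j ≡ 0)

cycle : (n : ℕ) → 3 ≤ n → Graph
cycle n 3≤n = record
  { Vertex     = Fin n
  ; order      = n
  ; finite     = ↔-id (Fin n)
  ; Adj        = λ i j → Next i j ⊎ Next j i
  ; adj-sym    = swap
  ; adj-irrefl = λ { refl (inj₁ p) → next-irrefl 3≤n p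
                   ; refl (inj₂ p) → next-irrefl 3≤n p }
  }
  where
  next-irrefl : ∀ {n} → 3 ≤ n → {i : Fin n} → ¬ Next i i
  next-irrefl _ (inj₁ i≡1+i) = 1+n≢n (sym i≡1+i)
  next-irrefl (s≤s (s≤s _)) {suc _} (inj₂ (_ , ()))
  next-irrefl (s≤s (s≤s _)) {zero}  (inj₂ (() , _))

infixr 7 _□_

_□_ : Graph → Graph → Graph
G □ H = record
  { Vertex     = Vertex G × Vertex H
  ; order      = order G * order H
  ; finite     = finite-□
  ; Adj        = λ (g , h) (g′ , h′) →
                   (g ≡ g′ × Adj H h h′) ⊎ (h ≡ h′ × Adj G g g′)
  ; adj-sym    = λ { (inj₁ (e , a)) → inj₁ (sym e , adj-sym H a)
                   ; (inj₂ (e , a)) → inj₂ (sym e , adj-sym G a) }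
  ; adj-irrefl = λ { refl (inj₁ (_ , a)) → adj-irrefl H refl a
                   ; refl (inj₂ (_ , a)) → adj-irrefl G refl a }
  }
  where
  finite-□ : (Vertex G × Vertex H) ↔ Fin (order G * order H)
  finite-□ = ↔-sym *↔× ↔-∘ (finite G ×-↔ finite H)

members↔ : ∀ {n} (D : Subset n) → ∃ (_∈ D) ↔ Fin ∣ D ∣
members↔ D = mk↔ₛ′ (to D) (from D) (to-from D) (from-to D)
  where
  to : ∀ {n} (D : Subset n) → ∃ (_∈ D) → Fin ∣ D ∣
  to (inside  ∷ D) (zero  , here)    = zero
  to (inside  ∷ D) (suc i , there p) = suc (to D (i , p))
  to (outside ∷ D) (suc i , there p) = to D (i , p)

  shift : ∀ {n} {s : Side} {D : Subset n} → ∃ (_∈ D) → ∃ (_∈ (s ∷ D))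
  shift (i , p) = suc i , there p

  from : ∀ {n} (D : Subset n) → Fin ∣ D ∣ → ∃ (_∈ D)
  from (inside  ∷ D) zero    = zero , here
  from (inside  ∷ D) (suc k) = shift (from D k)
  from (outside ∷ D) k       = shift (from D k)

  to-from : ∀ {n} (D : Subset n) k → to D (from D k) ≡ k
  to-from (inside  ∷ D) zero    = refl
  to-from (inside  ∷ D) (suc k) = cong suc (to-from D k)
  to-from (outside ∷ D) k       = to-from D k

  from-to : ∀ {n} (D : Subset n) x → from D (to D x) ≡ x
  from-to (inside  ∷ D) (zero  , here)    = refl
  from-to (inside  ∷ D) (suc i , there p) = cong shift (from-to D (i , p))
  from-to (outside ∷ D) (suc i , there p) = cong shift (from-to D (i , p))

induced : (G : Graph) → VertexSet G → Graph
induced G D = record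
  { Vertex     = ∃ λ v → _∈ᵥ_ G v D
  ; order      = ∣ D ∣
  ; finite     = members↔ D ↔-∘ Σ-Function.cong (finite G) (↔-id _)
  ; Adj        = Adj G on proj₁
  ; adj-sym    = adj-sym G
  ; adj-irrefl = λ e → adj-irrefl G (cong proj₁ e)
  }

-- A set of edges is given, like the edge set of a graph, by a symmetric
-- relation; it is a perfect matching if every vertex lies on exactly one of
-- its edges.
record PerfectMatching (G : Graph) : Set₁ where
  field
    Matched     : Rel (Vertex G) 0ℓ
    matched-sym : Symmetric Matched
    matched-adj : Matched ⇒ Adj G
    perfect     : ∀ v → ∃! _≡_ (Matched v)

IsTotalDominating : (G : Graph) → VertexSet G → Set
IsTotalDominating G D = ∀ v → HasNeighbourIn G v D

IsPairedDominating : (G : Graph) → VertexSet G → Set₁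
IsPairedDominating G D =
  (∀ v → _∉ᵥ_ G v D → HasNeighbourIn G v D) × PerfectMatching (induced G D)

IsMinimumSize : ∀ {ℓ : Level} {n} → (Subset n → Set ℓ) → ℕ → Set ℓ
IsMinimumSize P k =
  (∃ λ D → P D × ∣ D ∣ ≡ k) × (∀ D → P D → k ≤ ∣ D ∣)

-- The domination numbers are given by their graphs: γₜ[ G ]≡ k says that the
-- minimum defining γₜ(G) exists and equals k. A minimum is unique, so a common
-- value k of γₜ and γₚ expresses γₜ(G) = γₚ(G) = k.
γₜ[_]≡_ : Graph → ℕ → Set
γₜ[ G ]≡ k = IsMinimumSize (IsTotalDominating G) k

γₚ[_]≡_ : Graph → ℕ → Set₁
γₚ[ G ]≡ k = IsMinimumSize (IsPairedDominating G) k

{-# OPTIONS --safe #-}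
module Submission where

-- Lower bound: a vertex dominates four others, so 4 ∣D∣ ≥ 4 n. Along a diagonal,
-- let aᵢ and bᵢ indicate the cells (i , i) and (i , i + 2); domination of column
-- i + 1 involves only columns i, i + 1, i + 2 of this pair of sequences. If the
-- bound is attained, every vertex is dominated exactly once, which makes a − b
-- 2-periodic. But going round N ≡ 2 (mod 4) columns swaps a and b, so a = b, and
-- exactness then forces both to vanish. For n ≡ 2 (mod 4) this gains one on each
-- of the two diagonal classes; for odd n it applies to the double cover N = 2 n.
--
-- Upper bound: columns with the rows {0 , 1}, ∅, {2 , 3}, ∅, …, preceded by one
-- more column {2 , 3} if n ≡ 2 (mod 4); each pair is an edge of C₄.
open import Defs
open import Data.Nat using (ℕ; zero; suc; _+_; _*_; _≤_; _<_; _≤?_; _%_; _/_; z≤n; s≤s; NonZero; >-nonZero)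
open import Data.Nat.Properties
open import Data.Nat.DivMod
open import Data.Nat.Tactic.RingSolver using (solve-∀)
open import Algebra.Properties.CommutativeMonoid.Sum +-0-commutativeMonoid
  using (sum; sum-cong-≗; ∑-distrib-+)
open import Data.Bool using (Bool; true; false; if_then_else_)
open import Data.Fin using (Fin; zero; suc; toℕ; combine; remQuot)
open import Data.Fin.Patterns using (0F; 1F; 2F; 3F)
open import Data.Fin.Properties using (toℕ-fromℕ<; fromℕ<-cong; toℕ<n; toℕ-injective; remQuot-combine)
open import Data.Fin.Subset using (Subset; ∣_∣)
open import Data.Fin.Subset.Properties using (_∈?_)
open import Data.Product using (_×_; _,_; proj₁; proj₂; ∃; uncurry)
open import Data.Sum using (_⊎_; inj₁; inj₂; swap)
open import Data.Vec using ([]; _∷_; lookup; tabulate)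
open import Data.Vec.Properties using ([]=⇒lookup; lookup⇒[]=; lookup∘tabulate)
open import Data.Vec.Properties.WithK using ([]=-irrelevant)
open import Function using (_∘_; Inverse)
open import Relation.Binary.PropositionalEquality
  using (_≡_; _≢_; refl; sym; trans; cong; cong₂; subst; subst₂; module ≡-Reasoning)
open import Relation.Nullary using (Dec; yes; no; contradiction)
open import Relation.Nullary.Decidable using (from-yes)

-- Sums over initial segments and their rotation.

∑< : ℕ → (ℕ → ℕ) → ℕ
∑< n f = sum {n} (f ∘ toℕ)

∑<-cong : ∀ n {f g : ℕ → ℕ} → (∀ i → f i ≡ g i) → ∑< n f ≡ ∑< n g
∑<-cong n f≗g = sum-cong-≗ {n} (f≗g ∘ toℕ)

∑<-+ : ∀ n (f g : ℕ → ℕ) → ∑< n (λ i → f i + g i) ≡ ∑< n f + ∑< n g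
∑<-+ n f g = ∑-distrib-+ {n} (f ∘ toℕ) (g ∘ toℕ)

∑<-concat : ∀ m n (f : ℕ → ℕ) → ∑< (m + n) f ≡ ∑< m f + ∑< n (λ i → f (m + i))
∑<-concat zero    n f = refl
∑<-concat (suc m) n f =
  trans (cong (f 0 +_) (∑<-concat m n (f ∘ suc))) (sym (+-assoc (f 0) _ _))

∑<-snoc : ∀ n (f : ℕ → ℕ) → ∑< (suc n) f ≡ ∑< n f + f n
∑<-snoc zero    f = +-comm (f 0) 0
∑<-snoc (suc n) f =
  trans (cong (f 0 +_) (∑<-snoc n (f ∘ suc))) (sym (+-assoc (f 0) _ _))

∑<-bound : ∀ n {c} {f : ℕ → ℕ} → (∀ i → c ≤ f i) → n * c ≤ ∑< n f
∑<-bound zero    c≤f = z≤n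
∑<-bound (suc n) c≤f = +-mono-≤ (c≤f 0) (∑<-bound n (c≤f ∘ suc))

-- The terms after `f 0` already use up their share of the bound, so nothing is left for an excess
-- at 0. Any other index is handled by rotating the sum first.
∑<-tight : ∀ {n c} {f : ℕ → ℕ} → 0 < n → (∀ i → c ≤ f i) → ∑< n f ≤ n * c → f 0 ≤ c
∑<-tight {suc n} {c} {f} _ c≤f ∑≤ = +-cancelʳ-≤ (n * c) (f 0) c
  (≤-trans (+-monoʳ-≤ (f 0) (∑<-bound n (c≤f ∘ suc))) ∑≤)

∑<-rotate₁ : ∀ n (f : ℕ → ℕ) → (∀ i → f (n + i) ≡ f i) → ∑< n (f ∘ suc) ≡ ∑< n f
∑<-rotate₁ n f period = +-cancelˡ-≡ (f 0) _ _ (begin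
  f 0 + ∑< n (f ∘ suc)  ≡⟨ ∑<-snoc n f ⟩
  ∑< n f + f n          ≡⟨ +-comm (∑< n f) (f n) ⟩
  f n + ∑< n f          ≡⟨ cong (λ k → f k + ∑< n f) (sym (+-identityʳ n)) ⟩
  f (n + 0) + ∑< n f    ≡⟨ cong (_+ ∑< n f) (period 0) ⟩
  f 0 + ∑< n f          ∎)
  where open ≡-Reasoning

∑<-rotate : ∀ n (f : ℕ → ℕ) → (∀ i → f (n + i) ≡ f i) →
            ∀ k → ∑< n (λ i → f (k + i)) ≡ ∑< n f
∑<-rotate n f period zero    = refl
∑<-rotate n f period (suc k) = trans
  (∑<-rotate n (f ∘ suc) (λ i → trans (cong f (sym (+-suc n i))) (period (suc i))) k)
  (∑<-rotate₁ n f period)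

-- Weight of two sequences that dominate each other.

Dominated : (a b : ℕ → ℕ) → Set
Dominated a b = ∀ i → 1 ≤ (a (1 + i) + b (1 + i)) + (a (2 + i) + b i)

module DominatedPair
  (a b : ℕ → ℕ) (a-dom : Dominated a b) (b-dom : Dominated b a)
  (m : ℕ) (s-period : ∀ i → a ((m + m) + i) + b ((m + m) + i) ≡ a i + b i)
  where

  -- In the application `s i` counts the chosen cells of one diagonal class in column `i`, and `w i`
  -- counts, with multiplicity, the chosen neighbours of the two vertices of column `1 + i` outside
  -- that class.
  s w : ℕ → ℕ
  s i = a i + b i
  w i = ((a (1 + i) + b (1 + i)) + (a (2 + i) + b i)) +
        ((b (1 + i) + a (1 + i)) + (b (2 + i) + a i))

  2≤w : ∀ i → 2 ≤ w i
  2≤w i = +-mono-≤ (a-dom i) (b-dom i)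

  w≡s : ∀ i → w i ≡ (s (1 + i) + s (1 + i)) + (s (2 + i) + s i)
  w≡s i = rearrange (a (1 + i)) (b (1 + i)) (a (2 + i)) (b (2 + i)) (a i) (b i)
    where
    rearrange : ∀ a₁ b₁ a₂ b₂ a₀ b₀ →
      ((a₁ + b₁) + (a₂ + b₀)) + ((b₁ + a₁) + (b₂ + a₀)) ≡
      ((a₁ + b₁) + (a₁ + b₁)) + ((a₂ + b₂) + (a₀ + b₀))
    rearrange = solve-∀

  -- Double counting: each value of `s` enters twice from its own column and once from each adjacent
  -- one, and rotation aligns the shifted sums.
  ∑w : ∑< (m + m) w ≡ 4 * ∑< (m + m) s
  ∑w = begin
    ∑< N w
      ≡⟨ ∑<-cong N w≡s ⟩
    ∑< N (λ i → (s (1 + i) + s (1 + i)) + (s (2 + i) + s i))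
      ≡⟨ ∑<-+ N (λ i → s (1 + i) + s (1 + i)) (λ i → s (2 + i) + s i) ⟩
    ∑< N (λ i → s (1 + i) + s (1 + i)) + ∑< N (λ i → s (2 + i) + s i)
      ≡⟨ cong₂ _+_ (∑<-+ N (s ∘ suc) (s ∘ suc)) (∑<-+ N (λ i → s (2 + i)) s) ⟩
    (∑< N (s ∘ suc) + ∑< N (s ∘ suc)) + (∑< N (λ i → s (2 + i)) + ∑< N s)
      ≡⟨ cong₂ (λ x y → (x + x) + (y + ∑< N s)) (∑<-rotate N s s-period 1) (∑<-rotate N s s-period 2) ⟩
    (∑< N s + ∑< N s) + (∑< N s + ∑< N s)
      ≡⟨ quadruple (∑< N s) ⟩
    4 * ∑< N s ∎
    where
    open ≡-Reasoning
    N = m + m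
    quadruple : ∀ x → (x + x) + (x + x) ≡ 4 * x
    quadruple = solve-∀

  [m+m]*2≡4*m : ∀ k → (k + k) * 2 ≡ 4 * k
  [m+m]*2≡4*m = solve-∀

  weight-≥ : m ≤ ∑< (m + m) s
  weight-≥ = *-cancelˡ-≤ 4 (subst₂ _≤_ ([m+m]*2≡4*m m) ∑w (∑<-bound (m + m) 2≤w))

  w-period : ∀ i → w ((m + m) + i) ≡ w i
  w-period i = begin
    w (N + i)
      ≡⟨ w≡s (N + i) ⟩
    (s (1 + (N + i)) + s (1 + (N + i))) + (s (2 + (N + i)) + s (N + i))
      ≡⟨ cong₂ (λ x y → (x + x) + (y + s (N + i))) (shifted 1) (shifted 2) ⟩
    (s (1 + i) + s (1 + i)) + (s (2 + i) + s (N + i))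
      ≡⟨ cong (λ x → (s (1 + i) + s (1 + i)) + (s (2 + i) + x)) (s-period i) ⟩
    (s (1 + i) + s (1 + i)) + (s (2 + i) + s i)
      ≡⟨ sym (w≡s i) ⟩
    w i ∎
    where
    open ≡-Reasoning
    N = m + m
    swap+ : ∀ k n i → k + (n + i) ≡ n + (k + i)
    swap+ = solve-∀
    shifted : ∀ k → s (k + (N + i)) ≡ s (k + i)
    shifted k = trans (cong s (swap+ k N i)) (s-period (k + i))

  module Exact (m>0 : 0 < m) (∑s≤m : ∑< (m + m) s ≤ m) where

    -- The sum of `w` now equals its termwise lower bound; rotating by `k` brings the term `w k` to
    -- index 0, where `∑<-tight` applies.
    w≤2 : ∀ k → w k ≤ 2
    w≤2 k = subst (λ i → w i ≤ 2) (+-identityʳ k)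
      (∑<-tight (≤-trans m>0 (m≤m+n m m)) (λ i → 2≤w (k + i)) (begin
        ∑< N (λ i → w (k + i))  ≡⟨ ∑<-rotate N w w-period k ⟩
        ∑< N w                  ≡⟨ ∑w ⟩
        4 * ∑< N s              ≤⟨ *-monoʳ-≤ 4 ∑s≤m ⟩
        4 * m                   ≡⟨ sym ([m+m]*2≡4*m m) ⟩
        N * 2                   ∎))
      where
      open ≤-Reasoning
      N = m + m

    exact : ∀ {x y} → 1 ≤ x → 1 ≤ y → x + y ≤ 2 → x ≡ 1 × y ≡ 1
    exact {suc zero}    {suc zero}    _ _ _ = refl , refl
    exact {suc zero}    {suc (suc y)} _ _ (s≤s (s≤s ()))
    exact {suc (suc x)} {suc y}       _ _ (s≤s (s≤s p)) =
      contradiction (≤-trans (m≤n+m (suc y) x) p) λ ()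

    a-exact : ∀ i → (a (1 + i) + b (1 + i)) + (a (2 + i) + b i) ≡ 1
    a-exact i = proj₁ (exact (a-dom i) (b-dom i) (w≤2 i))

    b-exact : ∀ i → (b (1 + i) + a (1 + i)) + (b (2 + i) + a i) ≡ 1
    b-exact i = proj₂ (exact (a-dom i) (b-dom i) (w≤2 i))

    -- Both exact counts share the summand `a (1 + i) + b (1 + i)`, which cancels.
    step : ∀ i → a (2 + i) + b i ≡ b (2 + i) + a i
    step i = +-cancelˡ-≡ (a (1 + i) + b (1 + i)) _ _
      (trans (a-exact i) (sym (trans
        (cong (_+ (b (2 + i) + a i)) (+-comm (a (1 + i)) (b (1 + i)))) (b-exact i))))

    -- a − b is 2-periodic, with the negative terms moved across.
    difference : ∀ k i → a ((k + k) + i) + b i ≡ b ((k + k) + i) + a i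
    difference zero    i = +-comm (a i) (b i)
    difference (suc k) i rewrite +-suc k k =
      cancel (a (2 + i′)) (b (2 + i′)) (a i′) (b i′) (a i) (b i) (step i′) (difference k i)
      where
      i′ = (k + k) + i
      cancel : ∀ a₂ b₂ a₁ b₁ a₀ b₀ →
        a₂ + b₁ ≡ b₂ + a₁ → a₁ + b₀ ≡ b₁ + a₀ → a₂ + b₀ ≡ b₂ + a₀
      cancel a₂ b₂ a₁ b₁ a₀ b₀ p q = +-cancelʳ-≡ (b₁ + a₁) _ _ (begin
        (a₂ + b₀) + (b₁ + a₁)  ≡⟨ interchange a₂ b₀ b₁ a₁ ⟩
        (a₂ + b₁) + (a₁ + b₀)  ≡⟨ cong₂ _+_ p q ⟩
        (b₂ + a₁) + (b₁ + a₀)  ≡⟨ interchange′ b₂ a₁ b₁ a₀ ⟩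
        (b₂ + a₀) + (b₁ + a₁)  ∎)
        where
        open ≡-Reasoning
        interchange : ∀ x y z t → (x + y) + (z + t) ≡ (x + z) + (t + y)
        interchange = solve-∀
        interchange′ : ∀ x y z t → (x + y) + (z + t) ≡ (x + t) + (z + y)
        interchange′ = solve-∀

  weight-> : (∀ i → a ((m + m) + i) ≡ b i) → (∀ i → b ((m + m) + i) ≡ a i) →
             0 < m → m < ∑< (m + m) s
  weight-> a-twist b-twist m>0 with m <? ∑< (m + m) s
  ... | yes m<∑ = m<∑
  -- `a₊≡0` reaches positive indices only; the count at 1 is the first that avoids index 0.
  ... | no  m≮∑ = contradiction (a-exact 1) λ eq → 0≢1+n (trans (sym zeros) eq)
    where
    open Exact m>0 (≮⇒≥ m≮∑)

    double-injective : ∀ {x y} → x + x ≡ y + y → x ≡ y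
    double-injective {x} {y} eq = *-cancelˡ-≡ x y 2
      (trans (cong (x +_) (+-identityʳ x)) (trans eq (cong (y +_) (sym (+-identityʳ y)))))

    -- Since the length is even, steps of two lead from `i` to `(m + m) + i`, where the twists
    -- exchange the sequences: `b i + b i ≡ a i + a i`.
    a≡b : ∀ i → a i ≡ b i
    a≡b i = sym (double-injective (trans (cong (_+ b i) (sym (a-twist i)))
      (trans (difference m i) (cong (_+ a i) (b-twist i)))))

    bit≡0 : ∀ {x y r} → x ≡ y → (x + y) + r ≡ 1 → x ≡ 0
    bit≡0 {zero}  _    _  = refl
    bit≡0 {suc x} refl eq with () ← trans (sym (+-suc x x)) (m+n≡0⇒m≡0 _ (suc-injective eq))

    a₊≡0 : ∀ i → a (1 + i) ≡ 0
    a₊≡0 i = bit≡0 (a≡b (1 + i)) (a-exact i)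

    zeros : (a 2 + b 2) + (a 3 + b 1) ≡ 0
    zeros = cong₂ _+_
      (cong₂ _+_ (a₊≡0 1) (trans (sym (a≡b 2)) (a₊≡0 1)))
      (cong₂ _+_ (a₊≡0 2) (trans (sym (a≡b 1)) (a₊≡0 0)))

-- Periodic covers of the grid and their diagonals.

four-periodic : ∀ {A : Set} (f : ℕ → A) → (∀ j → f (4 + j) ≡ f j) →
                ∀ m j → f (m + j) ≡ f (m % 4 + j)
four-periodic f period 0 j = refl
four-periodic f period 1 j = refl
four-periodic f period 2 j = refl
four-periodic f period 3 j = refl
four-periodic f period (suc (suc (suc (suc m)))) j =
  trans (period (m + j)) (four-periodic f period m j)

-- Four consecutive rows make up a whole column wherever they start. The grouping by parity matches
-- the split into the two diagonal classes.
∑<4-window : (f : ℕ → ℕ) → (∀ j → f (4 + j) ≡ f j) →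
             ∀ k → (f k + f (2 + k)) + (f (1 + k) + f (3 + k)) ≡ ∑< 4 f
∑<4-window f period zero = rearrange (f 0) (f 1) (f 2) (f 3)
  where
  rearrange : ∀ x y z t → (x + z) + (y + t) ≡ x + (y + (z + (t + 0)))
  rearrange = solve-∀
∑<4-window f period (suc k) rewrite period k = trans
  (+-comm (f (1 + k) + f (3 + k)) (f (2 + k) + f k))
  (trans (cong (_+ (f (1 + k) + f (3 + k))) (+-comm (f (2 + k)) (f k)))
         (∑<4-window f period k))

record Covers (n : ℕ) (F : ℕ → ℕ → ℕ) : Set where
  field
    column-period : ∀ i j → F (n + i) j ≡ F i j
    row-period    : ∀ i j → F i (4 + j) ≡ F i j
    -- The neighbours of (1 + i , 1 + j), shifted so that no subtraction occurs.
    covered       : ∀ i j → 1 ≤ (F (1 + i) j + F (1 + i) (2 + j)) +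
                                (F (2 + i) (1 + j) + F i (1 + j))

-- One class takes rows `i` and `2 + i` of column `i`; the other two rows form the class of
-- `raise F`.
diagonal : (ℕ → ℕ → ℕ) → ℕ → ℕ
diagonal F i = F i i + F i (2 + i)

raise : (ℕ → ℕ → ℕ) → ℕ → ℕ → ℕ
raise F i j = F i (1 + j)

raise-covers : ∀ {n F} → Covers n F → Covers n (raise F)
raise-covers C = record
  { column-period = λ i j → column-period i (1 + j)
  ; row-period    = λ i j → row-period i (1 + j)
  ; covered       = λ i j → covered i (1 + j)
  }
  where open Covers C

double-covers : ∀ {n F} → Covers n F → Covers (n + n) F
double-covers {n} {F} C = record
  { column-period = λ i j → trans (cong (λ k → F k j) (+-assoc n n i))
                                  (trans (column-period (n + i) j) (column-period i j))
  ; row-period    = row-period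
  ; covered       = covered
  }
  where open Covers C

module _ {n F} (C : Covers n F) where
  open Covers C

  column-shift : ∀ i k → F (n + i) (n + k) ≡ F i (n % 4 + k)
  column-shift i k = trans (column-period i (n + k)) (four-periodic (F i) (row-period i) n k)

  -- One turn round the cycle raises the rows by `n % 4`: residue 0 fixes both cells, residue 2
  -- exchanges them, and odd residues lead to the other class.
  diagonal-shift : ∀ i → diagonal F (n + i) ≡ F i (n % 4 + i) + F i (2 + (n % 4 + i))
  diagonal-shift i = cong₂ _+_ (column-shift i i)
    (trans (column-period i (2 + (n + i)))
           (four-periodic (F i ∘ (2 +_)) (λ j → row-period i (2 + j)) n i))

  ∑diagonals : ∑< n (diagonal F) + ∑< n (diagonal (raise F)) ≡ ∑< n (∑< 4 ∘ F)
  ∑diagonals = trans (sym (∑<-+ n (diagonal F) (diagonal (raise F))))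
                     (∑<-cong n (λ i → ∑<4-window (F i) (row-period i) i))

  a b : ℕ → ℕ
  a i = F i i
  b i = F i (2 + i)

  a-dominated : Dominated a b
  a-dominated i = covered i (1 + i)

  -- This is domination of the vertex in column `1 + i` and row `i`. As `covered` speaks of a
  -- successor row, the row is written `4 + i`.
  b-dominated : Dominated b a
  b-dominated i = subst (1 ≤_)
    (cong₂ _+_ (cong (b (1 + i) +_) (row-period (1 + i) (1 + i)))
               (cong (b (2 + i) +_) (row-period i i)))
    (covered i (3 + i))

module _ {m F} (C : Covers (m + m) F) where
  open Covers C

  diagonal-≥ : (m + m) % 4 ≡ 0 → m ≤ ∑< (m + m) (diagonal F)
  diagonal-≥ r≡0 = weight-≥
    where
    open DominatedPair (a C) (b C) (a-dominated C) (b-dominated C) m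
      (λ i → trans (diagonal-shift C i)
                   (cong (λ r → F i (r + i) + F i (2 + (r + i))) r≡0))

  diagonal-> : (m + m) % 4 ≡ 2 → m < ∑< (m + m) (diagonal F)
  diagonal-> r≡2 = weight-> a-twist b-twist (m>0 m r≡2)
    where
    a-twist : ∀ i → F ((m + m) + i) ((m + m) + i) ≡ F i (2 + i)
    a-twist i = trans (column-shift C i i) (cong (λ r → F i (r + i)) r≡2)

    b-twist : ∀ i → F ((m + m) + i) (2 + ((m + m) + i)) ≡ F i i
    b-twist i = trans (column-period i _)
      (trans (four-periodic (F i ∘ (2 +_)) (λ j → row-period i (2 + j)) (m + m) i)
             (trans (cong (λ r → F i (2 + (r + i))) r≡2) (row-period i i)))

    m>0 : ∀ m → (m + m) % 4 ≡ 2 → 0 < m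
    m>0 (suc m) _ = s≤s z≤n

    open DominatedPair (a C) (b C) (a-dominated C) (b-dominated C) m
      (λ i → trans (cong₂ _+_ (a-twist i) (b-twist i)) (+-comm (F i (2 + i)) (F i i)))

-- Lower bounds by residue modulo 4.

even-half : ∀ n → n % 4 ≡ 0 ⊎ n % 4 ≡ 2 → ∃ λ m → n ≡ m + m
even-half 0 _ = 0 , refl
even-half 1 (inj₁ ())
even-half 1 (inj₂ ())
even-half 2 _ = 1 , refl
even-half 3 (inj₁ ())
even-half 3 (inj₂ ())
even-half (suc (suc (suc (suc n)))) r with even-half n r
... | m , refl = 2 + m , cong (2 +_) (sym (trans (+-suc m (suc m)) (cong suc (+-suc m m))))

odd-double : ∀ n → n % 4 ≡ 1 ⊎ n % 4 ≡ 3 → (n + n) % 4 ≡ 2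
odd-double n r = trans (%-distribˡ-+ n n 4) (residues r)
  where
  residues : n % 4 ≡ 1 ⊎ n % 4 ≡ 3 → (n % 4 + n % 4) % 4 ≡ 2
  residues (inj₁ r≡1) rewrite r≡1 = refl
  residues (inj₂ r≡3) rewrite r≡3 = refl

module _ {n F} (C : Covers n F) where
  open Covers C

  cover-≥-0 : n % 4 ≡ 0 → n ≤ ∑< n (∑< 4 ∘ F)
  cover-≥-0 r≡0 with even-half n (inj₁ r≡0)
  ... | m , refl = subst (m + m ≤_) (∑diagonals C)
    (+-mono-≤ (diagonal-≥ {m} C r≡0) (diagonal-≥ {m} (raise-covers C) r≡0))

  -- Each of the two diagonal classes has weight at least `suc m`, where `n` is `m + m`.
  cover-≥-2 : n % 4 ≡ 2 → n + 2 ≤ ∑< n (∑< 4 ∘ F)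
  cover-≥-2 r≡2 with even-half n (inj₂ r≡2)
  ... | m , refl = subst₂ _≤_ (add m) (∑diagonals C)
    (+-mono-≤ (diagonal-> {m} C r≡2) (diagonal-> {m} (raise-covers C) r≡2))
    where
    add : ∀ m → suc m + suc m ≡ (m + m) + 2
    add = solve-∀

  -- For odd n the diagonal closes up only after two turns round the cycle, the
  -- second of which runs along the other diagonal.
  cover-≥-odd : n % 4 ≡ 1 ⊎ n % 4 ≡ 3 → n + 1 ≤ ∑< n (∑< 4 ∘ F)
  cover-≥-odd r = subst₂ _≤_ (+-comm 1 n) two-turns
    (diagonal-> {n} (double-covers C) (odd-double n r))
    where
    second-turn : n % 4 ≡ 1 ⊎ n % 4 ≡ 3 → ∀ i → diagonal F (n + i) ≡ diagonal (raise F) i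
    second-turn (inj₁ r≡1) i = trans (diagonal-shift C i)
      (cong (λ r → F i (r + i) + F i (2 + (r + i))) r≡1)
    -- The rows are `3 + i` and `5 + i`; the latter is row `1 + i`, so the two cells of `raise F`
    -- appear in reverse order.
    second-turn (inj₂ r≡3) i = trans (diagonal-shift C i)
      (trans (cong (λ r → F i (r + i) + F i (2 + (r + i))) r≡3)
      (trans (cong (F i (3 + i) +_) (row-period i (1 + i)))
             (+-comm (F i (3 + i)) (F i (1 + i)))))

    two-turns : ∑< (n + n) (diagonal F) ≡ ∑< n (∑< 4 ∘ F)
    two-turns = trans (∑<-concat n n (diagonal F))
      (trans (cong (∑< n (diagonal F) +_) (∑<-cong n (second-turn r))) (∑diagonals C))

-- Subsets as indicator functions, with cyclic indices.

bit : Bool → ℕ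
bit x = if x then 1 else 0

-- `combine i j` places each column in four consecutive entries, so the vector is peeled off four
-- entries at a time.
∣∣-columns : ∀ n (D : Subset (n * 4)) →
             ∣ D ∣ ≡ sum {n} (λ i → sum {4} (λ j → bit (lookup D (combine i j))))
∣∣-columns zero    []                  = refl
∣∣-columns (suc n) (x ∷ y ∷ z ∷ t ∷ D) = begin
  ∣ x ∷ y ∷ z ∷ t ∷ D ∣
    ≡⟨ trans (∣∷∣ x (y ∷ z ∷ t ∷ D)) (cong (bit x +_)
       (trans (∣∷∣ y (z ∷ t ∷ D)) (cong (bit y +_)
       (trans (∣∷∣ z (t ∷ D)) (cong (bit z +_) (∣∷∣ t D)))))) ⟩
  bit x + (bit y + (bit z + (bit t + ∣ D ∣)))
    ≡⟨ cong (λ k → bit x + (bit y + (bit z + (bit t + k)))) (∣∣-columns n D) ⟩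
  bit x + (bit y + (bit z + (bit t + rest)))
    ≡⟨ assoc₄ (bit x) (bit y) (bit z) (bit t) rest ⟩
  (bit x + (bit y + (bit z + (bit t + 0)))) + rest ∎
  where
  open ≡-Reasoning
  rest = sum {n} (λ i → sum {4} (λ j → bit (lookup D (combine i j))))

  ∣∷∣ : ∀ {k} s (E : Subset k) → ∣ s ∷ E ∣ ≡ bit s + ∣ E ∣
  ∣∷∣ true  E = refl
  ∣∷∣ false E = refl

  assoc₄ : ∀ p q r s u → p + (q + (r + (s + u))) ≡ (p + (q + (r + (s + 0)))) + u
  assoc₄ = solve-∀

next-mod : ∀ {n} .{{_ : NonZero n}} i → Next (i mod n) (suc i mod n)
next-mod {n} i = go (suc (i % n) <? n)
  where
  open ≡-Reasoning

  toℕ-suc : toℕ (suc i mod n) ≡ suc (i % n) % n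
  toℕ-suc = begin
    toℕ (suc i mod n)                ≡⟨ toℕ-fromℕ< (m%n<n (suc i) n) ⟩
    suc i % n                        ≡⟨ cong (λ k → suc k % n) (m≡m%n+[m/n]*n i n) ⟩
    (suc (i % n) + (i / n) * n) % n  ≡⟨ [m+kn]%n≡m%n (suc (i % n)) (i / n) n ⟩
    suc (i % n) % n                  ∎

  suc-toℕ : suc (toℕ (i mod n)) ≡ suc (i % n)
  suc-toℕ = cong suc (toℕ-fromℕ< (m%n<n i n))

  go : Dec (suc (i % n) < n) → Next (i mod n) (suc i mod n)
  go (yes <n) = inj₁ (trans toℕ-suc (trans (m<n⇒m%n≡m <n) (sym suc-toℕ)))
  go (no  ≮n) = inj₂ (trans suc-toℕ last , trans toℕ-suc (trans (cong (_% n) last) (n%n≡0 n)))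
    where
    last : suc (i % n) ≡ n
    last = ≤-antisym (m%n<n i n) (≮⇒≥ ≮n)

next-functional : ∀ {n} {i j k : Fin n} → Next i j → Next i k → j ≡ k
next-functional (inj₁ p)       (inj₁ q)       = toℕ-injective (trans p (sym q))
next-functional (inj₂ (_ , p)) (inj₂ (_ , q)) = toℕ-injective (trans p (sym q))
next-functional {j = j} (inj₁ p) (inj₂ (q , _)) = contradiction (trans p q) (<⇒≢ (toℕ<n j))
next-functional {k = k} (inj₂ (q , _)) (inj₁ p) = contradiction (trans p q) (<⇒≢ (toℕ<n k))

next-injective : ∀ {n} {i j k : Fin n} → Next i k → Next j k → i ≡ j
next-injective (inj₁ p) (inj₁ q) = toℕ-injective (suc-injective (trans (sym p) q))
next-injective (inj₁ p) (inj₂ (_ , q)) = contradiction (trans (sym q) p) 0≢1+n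
next-injective (inj₂ (_ , q)) (inj₁ p) = contradiction (trans (sym q) p) 0≢1+n
next-injective (inj₂ (p , _)) (inj₂ (q , _)) = toℕ-injective (suc-injective (trans p (sym q)))

toℕ-mod : ∀ {n} .{{_ : NonZero n}} (i : Fin n) → toℕ i mod n ≡ i
toℕ-mod i = toℕ-injective (trans (toℕ-fromℕ< _) (m<n⇒m%n≡m (toℕ<n i)))

+-mod : ∀ {n} .{{_ : NonZero n}} i → (n + i) mod n ≡ i mod n
+-mod {n} i = fromℕ<-cong _ _ (trans (cong (_% n) (+-comm n i)) ([m+n]%n≡m%n i n)) _ _

-- A vertex has only one successor and one predecessor under `Next`, and `next-mod` exhibits both.
neighbour-mod : ∀ {n} .{{_ : NonZero n}} i {u} → Next (suc i mod n) u ⊎ Next u (suc i mod n) →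
                u ≡ suc (suc i) mod n ⊎ u ≡ i mod n
neighbour-mod i (inj₁ p) = inj₁ (next-functional p (next-mod (suc i)))
neighbour-mod i (inj₂ p) = inj₂ (next-injective p (next-mod i))

C₄ : Graph
C₄ = cycle 4 (from-yes (3 ≤? 4))

module _ (n : ℕ) (3≤n : 3 ≤ n) where

  G : Graph
  G = cycle n 3≤n □ C₄

  instance
    n≢0 : NonZero n
    n≢0 = >-nonZero (≤-trans (s≤s z≤n) 3≤n)

  indicator : Subset (n * 4) → ℕ → ℕ → ℕ
  indicator D i j = bit (lookup D (combine (i mod n) (j mod 4)))

  indicator-∈ : ∀ D {i j u v} → Graph._∈ᵥ_ G (u , v) D → u ≡ i mod n → v ≡ j mod 4 →
                1 ≤ indicator D i j
  indicator-∈ D u∈D refl refl = ≤-reflexive (sym (cong bit ([]=⇒lookup u∈D)))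

  ∣∣-indicator : ∀ D → ∣ D ∣ ≡ ∑< n (∑< 4 ∘ indicator D)
  ∣∣-indicator D = trans (∣∣-columns n D)
    (sum-cong-≗ {n} λ i → sum-cong-≗ {4} λ j →
      cong₂ (λ u v → bit (lookup D (combine u v))) (sym (toℕ-mod i)) (sym (toℕ-mod j)))

  indicator-covers : ∀ D → IsTotalDominating G D → Covers n (indicator D)
  indicator-covers D total = record
    { column-period = λ i j → cong (λ u → bit (lookup D (combine {n} u (j mod 4)))) (+-mod i)
    ; row-period    = λ i j → refl
    ; covered       = covered
    }
    where
    F = indicator D
    covered : ∀ i j → 1 ≤ (F (1 + i) j + F (1 + i) (2 + j)) + (F (2 + i) (1 + j) + F i (1 + j))
    covered i j with total (suc i mod n , suc j mod 4)
    ... | (u , v) , inj₁ (eq , adj) , uv∈D with neighbour-mod j adj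
    ...   | inj₁ v≡ = m≤n⇒m≤n+o _ (m≤n⇒m≤o+n (F (1 + i) j)
                        (indicator-∈ D {1 + i} {2 + j} uv∈D (sym eq) v≡))
    ...   | inj₂ v≡ = m≤n⇒m≤n+o _ (m≤n⇒m≤n+o _ (indicator-∈ D {1 + i} {j} uv∈D (sym eq) v≡))
    covered i j | (u , v) , inj₂ (eq , adj) , uv∈D with neighbour-mod i adj
    ...   | inj₁ u≡ = m≤n⇒m≤o+n (F (1 + i) j + F (1 + i) (2 + j))
                        (m≤n⇒m≤n+o _ (indicator-∈ D {2 + i} {1 + j} uv∈D u≡ (sym eq)))
    ...   | inj₂ u≡ = m≤n⇒m≤o+n (F (1 + i) j + F (1 + i) (2 + j))
                        (m≤n⇒m≤o+n (F (2 + i) (1 + j))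
                          (indicator-∈ D {i} {1 + j} uv∈D u≡ (sym eq)))

-- Sets built from column patterns.

data Column : Set where
  none low high : Column

cell : Column → Fin 4 → Bool
cell none _                         = false
cell low  zero                      = true
cell low  (suc zero)                = true
cell low  (suc (suc _))             = false
cell high zero                      = false
cell high (suc zero)                = false
cell high (suc (suc _))             = true

size : Column → ℕ
size none = 0
size low  = 2
size high = 2

∑cell : ∀ c → sum {4} (λ j → bit (cell c j)) ≡ size c
∑cell none = refl
∑cell low  = refl
∑cell high = refl

low-or-high : ∀ j → cell low j ≡ true ⊎ cell high j ≡ true
low-or-high zero          = inj₁ refl
low-or-high (suc zero)    = inj₁ refl
low-or-high (suc (suc _)) = inj₂ refl

-- The perfect matching of C₄ with edges {0 , 1} and {2 , 3}, chosen so that every `Column` is a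
-- union of its edges.
mate : Fin 4 → Fin 4
mate 0F = 1F
mate 1F = 0F
mate 2F = 3F
mate 3F = 2F

mate-involutive : ∀ j → mate (mate j) ≡ j
mate-involutive 0F = refl
mate-involutive 1F = refl
mate-involutive 2F = refl
mate-involutive 3F = refl

mate-adj : ∀ j → Graph.Adj C₄ j (mate j)
mate-adj 0F = inj₁ (inj₁ refl)
mate-adj 1F = inj₂ (inj₁ refl)
mate-adj 2F = inj₁ (inj₁ refl)
mate-adj 3F = inj₂ (inj₁ refl)

cell-mate : ∀ c j → cell c (mate j) ≡ cell c j
cell-mate none _  = refl
cell-mate low  0F = refl
cell-mate low  1F = refl
cell-mate low  2F = refl
cell-mate low  3F = refl
cell-mate high 0F = refl
cell-mate high 1F = refl
cell-mate high 2F = refl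
cell-mate high 3F = refl

-- The two ends of an edge of C₄ dominate each other and the two remaining vertices.
column-total : ∀ c → c ≢ none → ∀ j → ∃ λ k → Graph.Adj C₄ j k × cell c k ≡ true
column-total none c≢ _  = contradiction refl c≢
column-total low  _  0F = 1F , inj₁ (inj₁ refl) , refl
column-total low  _  1F = 0F , inj₂ (inj₁ refl) , refl
column-total low  _  2F = 1F , inj₂ (inj₁ refl) , refl
column-total low  _  3F = 0F , inj₁ (inj₂ (refl , refl)) , refl
column-total high _  0F = 3F , inj₂ (inj₂ (refl , refl)) , refl
column-total high _  1F = 2F , inj₁ (inj₁ refl) , refl
column-total high _  2F = 3F , inj₁ (inj₁ refl) , refl
column-total high _  3F = 2F , inj₂ (inj₁ refl) , refl

none? : ∀ c → Dec (c ≡ none)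
none? none = yes refl
none? low  = no λ ()
none? high = no λ ()

Opposite : Column → Column → Set
Opposite c d = (c ≡ low × d ≡ high) ⊎ (c ≡ high × d ≡ low)

opposite-covers : ∀ {c d} → Opposite c d → ∀ j → cell c j ≡ true ⊎ cell d j ≡ true
opposite-covers (inj₁ (refl , refl)) j = low-or-high j
opposite-covers (inj₂ (refl , refl)) j = swap (low-or-high j)

-- Conditions making each empty column lie between complementary ones. `wrap` concerns an empty last
-- column: its right neighbour is column 0, whereas `between` speaks of `P n`.
record Arrangement (n : ℕ) (P : ℕ → Column) : Set where
  field
    first   : P 0 ≢ none
    between : ∀ k → P (1 + k) ≡ none → Opposite (P k) (P (2 + k))
    wrap    : ∀ k → 1 + k ≡ n → P k ≡ none → P n ≡ P 0

module _ (n : ℕ) (3≤n : 3 ≤ n) (P : ℕ → Column) where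

  open Graph (G n 3≤n) using (_∈ᵥ_)
  instance _ = n≢0 n 3≤n

  arranged : Subset (n * 4)
  arranged = tabulate (uncurry (λ i j → cell (P (toℕ i)) j) ∘ remQuot {n} 4)

  lookup-arranged : ∀ i j → lookup arranged (combine i j) ≡ cell (P (toℕ i)) j
  lookup-arranged i j = trans (lookup∘tabulate _ (combine i j))
    (cong (uncurry (λ i j → cell (P (toℕ i)) j)) (remQuot-combine {n} i j))

  ∣arranged∣ : ∣ arranged ∣ ≡ ∑< n (size ∘ P)
  ∣arranged∣ = trans (∣∣-columns n arranged) (sum-cong-≗ {n} λ i →
    trans (sum-cong-≗ {4} (λ j → cong bit (lookup-arranged i j))) (∑cell (P (toℕ i))))

  ∈-arranged⁺ : ∀ i j → cell (P (toℕ i)) j ≡ true → (i , j) ∈ᵥ arranged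
  ∈-arranged⁺ i j eq = lookup⇒[]= (combine i j) arranged (trans (lookup-arranged i j) eq)

  ∈-arranged⁻ : ∀ i j → (i , j) ∈ᵥ arranged → cell (P (toℕ i)) j ≡ true
  ∈-arranged⁻ i j p = trans (sym (lookup-arranged i j)) ([]=⇒lookup p)

  arranged-matching : PerfectMatching (induced (G n 3≤n) arranged)
  arranged-matching = record
    { Matched     = λ { ((i , j) , _) ((k , l) , _) → i ≡ k × mate j ≡ l }
    ; matched-sym = λ { {(i , j) , _} (refl , refl) → refl , mate-involutive j }
    ; matched-adj = λ { {(i , j) , _} (refl , refl) → inj₁ (refl , mate-adj j) }
    ; perfect     = λ { ((i , j) , p) →
        ((i , mate j) ,
         ∈-arranged⁺ i (mate j) (trans (cell-mate (P (toℕ i)) j) (∈-arranged⁻ i j p))) ,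
        (refl , refl) ,
        -- Vertices of the induced graph carry membership proofs, so uniqueness of the partner also
        -- needs these to be equal.
        λ { {(_ , _) , q} (refl , refl) → cong (_ ,_) ([]=-irrelevant _ q) } }
    }

  module _ (A : Arrangement n P) where
    open Arrangement A

    Flanked : Fin n → Set
    Flanked i = ∃ λ u → ∃ λ v →
      Graph.Adj (cycle n 3≤n) i u × Graph.Adj (cycle n 3≤n) i v ×
      Opposite (P (toℕ u)) (P (toℕ v))

    flanks : ∀ i → P (toℕ i) ≡ none → Flanked i
    flanks i = go (toℕ i) (toℕ<n i) (toℕ-mod i)
      where
      go : ∀ k → k < n → k mod n ≡ i → P k ≡ none → Flanked i
      go zero    _     _    P0≡none = contradiction P0≡none first
      go (suc k) 1+k<n refl P≡none =
        k mod n , (2 + k) mod n , inj₂ (next-mod {n} k) , inj₁ (next-mod {n} (suc k)) ,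
        subst₂ Opposite (sym P-prev) (sym P-next) (between k P≡none)
        where
        P-mod : ∀ j → j < n → P (toℕ (j mod n)) ≡ P j
        P-mod j j<n = cong P (trans (toℕ-fromℕ< (m%n<n j n)) (m<n⇒m%n≡m j<n))

        P-prev : P (toℕ (k mod n)) ≡ P k
        P-prev = P-mod k (<-trans (n<1+n k) 1+k<n)

        P-next : P (toℕ ((2 + k) mod n)) ≡ P (2 + k)
        P-next with m≤n⇒m<n∨m≡n 1+k<n
        ... | inj₁ 2+k<n = P-mod (2 + k) 2+k<n
        -- Here the empty column is the last one, and its successor is column 0.
        ... | inj₂ 2+k≡n = begin
          P (toℕ ((2 + k) mod n))  ≡⟨ cong P (toℕ-fromℕ< (m%n<n (2 + k) n)) ⟩
          P ((2 + k) % n)          ≡⟨ cong (λ m → P (m % n)) 2+k≡n ⟩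
          P (n % n)                ≡⟨ cong P (n%n≡0 n) ⟩
          P 0                      ≡⟨ sym (wrap (suc k) 2+k≡n P≡none) ⟩
          P n                      ≡⟨ cong P (sym 2+k≡n) ⟩
          P (2 + k)                ∎
          where open ≡-Reasoning

    arranged-total : IsTotalDominating (G n 3≤n) arranged
    arranged-total (i , j) with none? (P (toℕ i))
    ... | no  c≢none with column-total (P (toℕ i)) c≢none j
    ...   | k , adj , k∈c = (i , k) , inj₁ (refl , adj) , ∈-arranged⁺ i k k∈c
    arranged-total (i , j) | yes c≡none with flanks i c≡none
    ... | u , v , adj-u , adj-v , opp with opposite-covers opp j
    ...   | inj₁ j∈u = (u , j) , inj₂ (refl , adj-u) , ∈-arranged⁺ u j j∈u
    ...   | inj₂ j∈v = (v , j) , inj₂ (refl , adj-v) , ∈-arranged⁺ v j j∈v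

-- The explicit arrangements.

stripes : ℕ → Column
stripes 0 = low
stripes 1 = none
stripes 2 = high
stripes 3 = none
stripes (suc (suc (suc (suc i)))) = stripes i

stripes-between : ∀ k → stripes (1 + k) ≡ none → Opposite (stripes k) (stripes (2 + k))
stripes-between 0 _ = inj₁ (refl , refl)
stripes-between 1 ()
stripes-between 2 _ = inj₂ (refl , refl)
stripes-between 3 ()
stripes-between (suc (suc (suc (suc k)))) = stripes-between k

stripes-%4≡0 : ∀ n → n % 4 ≡ 0 → stripes n ≡ low
stripes-%4≡0 0 _ = refl
stripes-%4≡0 (suc (suc (suc (suc n)))) r = stripes-%4≡0 n r

-- For odd `n` the last column has an even index and is occupied, which makes `wrap` vacuous.
stripes-odd : ∀ k → suc k % 4 ≡ 1 ⊎ suc k % 4 ≡ 3 → stripes k ≢ none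
stripes-odd 0 _ ()
stripes-odd 1 (inj₁ ())
stripes-odd 1 (inj₂ ())
stripes-odd 2 _ ()
stripes-odd 3 (inj₁ ())
stripes-odd 3 (inj₂ ())
stripes-odd (suc (suc (suc (suc k)))) r = stripes-odd k r

∑stripes-0 : ∀ n → n % 4 ≡ 0 → ∑< n (size ∘ stripes) ≡ n
∑stripes-0 0 _ = refl
∑stripes-0 (suc (suc (suc (suc n)))) r = cong (4 +_) (∑stripes-0 n r)

∑stripes-odd : ∀ n → n % 4 ≡ 1 ⊎ n % 4 ≡ 3 → ∑< n (size ∘ stripes) ≡ n + 1
∑stripes-odd 0 (inj₁ ())
∑stripes-odd 0 (inj₂ ())
∑stripes-odd 1 _ = refl
∑stripes-odd 2 (inj₁ ())
∑stripes-odd 2 (inj₂ ())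
∑stripes-odd 3 _ = refl
∑stripes-odd (suc (suc (suc (suc n)))) r = cong (4 +_) (∑stripes-odd n r)

stripes-arrangement : ∀ n → (∀ k → 1 + k ≡ n → stripes k ≡ none → stripes n ≡ low) →
                      Arrangement n stripes
stripes-arrangement n wrap = record
  { first = λ () ; between = stripes-between ; wrap = wrap }

-- For `n % 4 ≡ 2` plain stripes would end in an empty column with `low` on both sides. After the
-- extra column, the stripes have length 1 modulo 4 and end in an occupied column.
stripes⁺ : ℕ → Column
stripes⁺ zero    = high
stripes⁺ (suc i) = stripes i

pred-%4≡2 : ∀ n → suc n % 4 ≡ 2 → n % 4 ≡ 1
pred-%4≡2 1 _ = refl
pred-%4≡2 (suc (suc (suc (suc n)))) r = pred-%4≡2 n r

stripes⁺-arrangement : ∀ n → n % 4 ≡ 2 → Arrangement n stripes⁺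
stripes⁺-arrangement n r = record
  { first   = λ ()
  -- The case 0 is absurd, since column 1 is `low`.
  ; between = λ { (suc k) → stripes-between k }
  ; wrap    = λ { (suc k) refl empty → contradiction empty
                    (stripes-odd k (inj₁ (pred-%4≡2 (suc k) r))) }
  }

∑stripes⁺ : ∀ n → n % 4 ≡ 2 → ∑< n (size ∘ stripes⁺) ≡ n + 2
∑stripes⁺ (suc n) r = begin
  2 + ∑< n (size ∘ stripes)  ≡⟨ cong (2 +_) (∑stripes-odd n (inj₁ (pred-%4≡2 n r))) ⟩
  2 + (n + 1)                ≡⟨ regroup n ⟩
  suc n + 2                  ∎
  where
  open ≡-Reasoning
  regroup : ∀ n → 2 + (n + 1) ≡ suc n + 2
  regroup = solve-∀

-- Combining the bounds for both domination numbers.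

paired⇒total : ∀ G D → IsPairedDominating G D → IsTotalDominating G D
paired⇒total G D (dominated , matching) v with Inverse.to (Graph.finite G) v ∈? D
... | no  v∉D = dominated v v∉D
... | yes v∈D with PerfectMatching.perfect matching (v , v∈D)
...   | (u , u∈D) , matched , _ = u , PerfectMatching.matched-adj matching matched , u∈D

-- One set attains both minima, and the lower bound carries over because a member of a paired
-- dominating set has its partner as a neighbour.
minimum-total-and-paired : ∀ G {k} (D : Graph.VertexSet G) →
  IsTotalDominating G D → PerfectMatching (induced G D) → ∣ D ∣ ≡ k →
  (∀ E → IsTotalDominating G E → k ≤ ∣ E ∣) →
  (γₜ[ G ]≡ k) × (γₚ[ G ]≡ k)
minimum-total-and-paired G D total matching ∣D∣≡k lower =
  ((D , total , ∣D∣≡k) , lower) ,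
  ((D , ((λ v _ → total v) , matching) , ∣D∣≡k) ,
   λ E paired → lower E (paired⇒total G E paired))

-- H is kept apart from G n 3≤n because comparing the two inside γₜ and γₚ would
-- normalise the vertex enumerations; the equation H ≡ G is checked directly.
total-and-paired : ∀ n (3≤n : 3 ≤ n) H {k P} → G n 3≤n ≡ H →
  Arrangement n P → ∑< n (size ∘ P) ≡ k →
  (∀ {F} → Covers n F → k ≤ ∑< n (∑< 4 ∘ F)) →
  (γₜ[ H ]≡ k) × (γₚ[ H ]≡ k)
total-and-paired n 3≤n _ {k} {P} refl A ∑≡k bound =
  minimum-total-and-paired (G n 3≤n) (arranged n 3≤n P)
    (arranged-total n 3≤n P A) (arranged-matching n 3≤n P)
    (trans (∣arranged∣ n 3≤n P) ∑≡k)
    (λ E total → subst (k ≤_) (sym (∣∣-indicator n 3≤n E))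
                              (bound (indicator-covers n 3≤n E total)))

theorem4p1 : (n : ℕ) (3≤n : 3 ≤ n) →
    let G = cycle n 3≤n □ cycle 4 (from-yes (3 ≤? 4)) in
    (n % 4 ≡ 0 → (γₜ[ G ]≡ n) × (γₚ[ G ]≡ n)) ×
    (n % 4 ≡ 1 ⊎ n % 4 ≡ 3 → (γₜ[ G ]≡ (n + 1)) × (γₚ[ G ]≡ (n + 1))) ×
    (n % 4 ≡ 2 → (γₜ[ G ]≡ (n + 2)) × (γₚ[ G ]≡ (n + 2)))
theorem4p1 n 3≤n = let C = cycle n 3≤n □ cycle 4 (from-yes (3 ≤? 4)) in
  (λ r → total-and-paired n 3≤n C refl
    (stripes-arrangement n (λ _ _ _ → stripes-%4≡0 n r)) (∑stripes-0 n r)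
    (λ F → cover-≥-0 F r)) ,
  (λ r → total-and-paired n 3≤n C refl
    (stripes-arrangement n (λ { k refl empty → contradiction empty (stripes-odd k r) }))
    (∑stripes-odd n r)
    (λ F → cover-≥-odd F r)) ,
  (λ r → total-and-paired n 3≤n C refl (stripes⁺-arrangement n r) (∑stripes⁺ n r)
    (λ F → cover-≥-2 F r))
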